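{- Let $P$ and $Q$ be LTSs with the same signature $\{A^r,A^l,A^{bi}\}$, and let $R\subseteq P\times Q$ be a relation between their states. Put $\mathcal{M}(R)=R\cup\{(u,q)\mid q \text{ a state of } \mathcal{M}(Q)\}$, where the first component $u$ is the extra state of $\mathcal{M}(P)$. Then $R$ is a covariant-contravariant simulation between $P$ and $Q$ if and only if $\mathcal{M}(R)$ is a refinement relation between $\mathcal{M}(P)$ and $\mathcal{M}(Q)$.
   Context: A modal transition system (MTS) over a set of actions $A$ is a triple $(P,\to_\Diamond,\to_\Box)$ with $P$ a set of states and $\to_\Box\subseteq\to_\Diamond\subseteq P\times A\times P$ (must transitions $\to_\Box$, may transitions $\to_\Diamond$). A relation $R\subseteq P\times Q$ is a refinement relation between MTSs $P$ and $Q$ (over the same actions) if whenever $p\,R\,q$: (i) $p\xrightarrow{a}_\Box p'$ implies there is $q'$ with $q\xrightarrow{a}_\Box q'$ and $p'\,R\,q'$; (ii) $q\xrightarrow{a}_\Diamond q'$ implies there is $p'$ with $p\xrightarrow{a}_\Diamond p'$ and $p'\,R\,q'$. A labelled transition system (LTS) over $A$ is a set of states $P$ with a transition relation $\to\subseteq P\times A\times P$. A signature is a partition $\{A^r,A^l,A^{bi}\}$ of $A$ into pairwise disjoint, possibly empty sets. A covariant-contravariant simulation between LTSs $P$ and $Q$ with this signature is a relation $R\subseteq P\times Q$ such that whenever $p\,R\,q$: for all $a\in A^r\cup A^{bi}$ and $p\xrightarrow{a}p'$ there is $q\xrightarrow{a}q'$ with $p'\,R\,q'$; and for all $a\in A^l\cup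 A^{bi}$ and $q\xrightarrow{a}q'$ there is $p\xrightarrow{a}p'$ with $p'\,R\,q'$. For an LTS $P$ with signature $\{A^r,A^l,A^{bi}\}$, the MTS $\mathcal{M}(P)$ over $A=A^r\cup A^l\cup A^{bi}$ has as states those of $P$ plus a new state $u$, and exactly the following transitions: $p\xrightarrow{a}_\Diamond p'$ for each $p\xrightarrow{a}p'$ in $P$; $p\xrightarrow{a}_\Box p'$ for each $p\xrightarrow{a}p'$ in $P$ with $a\in A^r\cup A^{bi}$; $p\xrightarrow{a}_\Diamond u$ for each $a\in A^r$ and state $p$ of $P$; $u\xrightarrow{a}_\Diamond u$ for each $a\in A$. -}

module Defs where

open import Level using (Level; _⊔_; suc)
open import Data.Maybe.Base using (Maybe; just; nothing)
open import Data.Product.Base using (_×_; ∃-syntax)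
open import Relation.Binary.Core using (REL)
open import Relation.Unary using (Pred; _∈_; _∪_; _⊥_; Universal)

private
  variable
    a ℓ s t s₁ t₁ t₁′ s₂ t₂ t₂′ r : Level
    A : Set a

record LTS (A : Set a) (s t : Level) : Set (a ⊔ suc (s ⊔ t)) where
  field
    State  : Set s
    _⟶[_]_ : State → A → State → Set t

record MTS (A : Set a) (s t t′ : Level) : Set (a ⊔ suc (s ⊔ t ⊔ t′)) where
  field
    State   : Set s
    _⟶◇[_]_ : State → A → State → Set t
    _⟶□[_]_ : State → A → State → Set t′
    □⇒◇     : ∀ {p x p′} → p ⟶□[ x ] p′ → p ⟶◇[ x ] p′

-- Since _∪_ is a constructive disjunction, `cover` decides the class of
-- every action.
record Signature (A : Set a) (ℓ : Level) : Set (a ⊔ suc ℓ) where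
  field
    Aʳ Aˡ Aᵇⁱ : Pred A ℓ
    cover     : Universal (Aʳ ∪ Aˡ ∪ Aᵇⁱ)
    r⊥l       : Aʳ ⊥ Aˡ
    r⊥bi      : Aʳ ⊥ Aᵇⁱ
    l⊥bi      : Aˡ ⊥ Aᵇⁱ

record IsRefinement {A : Set a} (P : MTS A s₁ t₁ t₁′) (Q : MTS A s₂ t₂ t₂′)
                    (R : REL (MTS.State P) (MTS.State Q) r)
                    : Set (a ⊔ s₁ ⊔ t₁ ⊔ t₁′ ⊔ s₂ ⊔ t₂ ⊔ t₂′ ⊔ r) where
  private
    module P = MTS P
    module Q = MTS Q
  field
    must : ∀ {p q} → R p q → ∀ {x p′} → p P.⟶□[ x ] p′ →
           ∃[ q′ ] (q Q.⟶□[ x ] q′ × R p′ q′)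
    may  : ∀ {p q} → R p q → ∀ {x q′} → q Q.⟶◇[ x ] q′ →
           ∃[ p′ ] (p P.⟶◇[ x ] p′ × R p′ q′)

record IsCCSimulation {A : Set a} (S : Signature A ℓ)
                      (P : LTS A s₁ t₁) (Q : LTS A s₂ t₂)
                      (R : REL (LTS.State P) (LTS.State Q) r)
                      : Set (a ⊔ ℓ ⊔ s₁ ⊔ t₁ ⊔ s₂ ⊔ t₂ ⊔ r) where
  open Signature S
  private
    module P = LTS P
    module Q = LTS Q
  field
    covariant     : ∀ {p q} → R p q →
                    ∀ {x p′} → x ∈ Aʳ ∪ Aᵇⁱ → p P.⟶[ x ] p′ →
                    ∃[ q′ ] (q Q.⟶[ x ] q′ × R p′ q′)
    contravariant : ∀ {p q} → R p q →
                    ∀ {x q′} → x ∈ Aˡ ∪ Aᵇⁱ → q Q.⟶[ x ] q′ →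
                    ∃[ p′ ] (p P.⟶[ x ] p′ × R p′ q′)

-- The states of ℳ(P) are `just p` for p a state of P, and the new state u.
pattern u = nothing

module _ {A : Set a} (S : Signature A ℓ) (P : LTS A s t) where
  open Signature S
  open LTS P

  data ℳ-May : Maybe State → A → Maybe State → Set (a ⊔ ℓ ⊔ s ⊔ t) where
    step : ∀ {p x p′} → p ⟶[ x ] p′ → ℳ-May (just p) x (just p′)
    to-u : ∀ {p x} → x ∈ Aʳ → ℳ-May (just p) x u
    loop : ∀ {x} → ℳ-May u x u

  data ℳ-Must : Maybe State → A → Maybe State → Set (a ⊔ ℓ ⊔ s ⊔ t) where
    step : ∀ {p x p′} → x ∈ Aʳ ∪ Aᵇⁱ → p ⟶[ x ] p′ →
           ℳ-Must (just p) x (just p′)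

  ℳ : MTS A s (a ⊔ ℓ ⊔ s ⊔ t) (a ⊔ ℓ ⊔ s ⊔ t)
  ℳ = record
    { State   = Maybe State
    ; _⟶◇[_]_ = ℳ-May
    ; _⟶□[_]_ = ℳ-Must
    ; □⇒◇     = λ { (step _ p⟶p′) → step p⟶p′ }
    }

data ℳ-Rel {X : Set s₁} {Y : Set s₂} (R : REL X Y r)
           : REL (Maybe X) (Maybe Y) (s₁ ⊔ s₂ ⊔ r) where
  base  : ∀ {p q} → R p q → ℳ-Rel R (just p) (just q)
  u-any : ∀ {q} → ℳ-Rel R u q

{-# OPTIONS --safe #-}
module Submission where

open import Defs
open import Level using (Level)
open import Data.Maybe.Base using (just)
open import Data.Product.Base using (_,_)
open import Data.Sum.Base using ([_,_]′)
open import Function.Base using (case_of_)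
open import Function.Bundles using (_⇔_; mk⇔)
open import Relation.Binary.Core using (REL)
open import Relation.Nullary using (¬_; contradiction)
open import Relation.Unary using (_∈_; _∪_)

-- The state u has no must transitions and loops under every action, so it
-- refines everything.  Hence the may transitions labelled in Aʳ, which a
-- covariant-contravariant simulation does not constrain, are always matched
-- by the move to u; no such move exists for the labels in Aˡ ∪ Aᵇⁱ.

module _ {a ℓ} {A : Set a} (S : Signature A ℓ) where
  open Signature S

  -- Serves to exclude `u` as the answer to a contravariant step: moves from a state of P into `u`
  -- carry labels in `Aʳ` only.
  l∪bi⇒¬r : ∀ {x} → x ∈ Aˡ ∪ Aᵇⁱ → ¬ x ∈ Aʳ
  l∪bi⇒¬r x∈l∪bi x∈r =
    [ (λ x∈l → r⊥l (x∈r , x∈l)) , (λ x∈bi → r⊥bi (x∈r , x∈bi)) ]′ x∈l∪bi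

  module _ {s₁ t₁ s₂ t₂ r} {P : LTS A s₁ t₁} {Q : LTS A s₂ t₂}
           {R : REL (LTS.State P) (LTS.State Q) r} where

    ccSimulation⇒refinement : IsCCSimulation S P Q R →
                              IsRefinement (ℳ S P) (ℳ S Q) (ℳ-Rel R)
    ccSimulation⇒refinement sim = record
      { must = λ where
          (base pRq) (step x∈ p⟶p′) →
            let q′ , q⟶q′ , p′Rq′ = covariant pRq x∈ p⟶p′
            in  just q′ , step x∈ q⟶q′ , base p′Rq′
      ; may  = λ where
          u-any      _          → u , loop , u-any
          (base _)   (to-u x∈r) → u , to-u x∈r , u-any
          -- A may transition does not record the class of its label, so `cover` decides which
          -- answer to give.
          (base pRq) (step {x = x} q⟶q′) →
            [ (λ x∈r → u , to-u x∈r , u-any)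
            , (λ x∈l∪bi →
                 let p′ , p⟶p′ , p′Rq′ = contravariant pRq x∈l∪bi q⟶q′
                 in  just p′ , step p⟶p′ , base p′Rq′)
            ]′ (cover x)
      }
      where open IsCCSimulation sim

    refinement⇒ccSimulation : IsRefinement (ℳ S P) (ℳ S Q) (ℳ-Rel R) →
                              IsCCSimulation S P Q R
    refinement⇒ccSimulation ref = record
      { covariant     = λ pRq x∈ p⟶p′ →
          case must (base pRq) (step x∈ p⟶p′) of λ where
            -- The first component `just p′` is not `u`, so the pair can only come from `R`.
            (_ , step _ q⟶q′ , base p′Rq′) → _ , q⟶q′ , p′Rq′
      ; contravariant = λ pRq x∈l∪bi q⟶q′ →
          case may (base pRq) (step q⟶q′) of λ where
            (_ , step p⟶p′ , base p′Rq′) → _ , p⟶p′ , p′Rq′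
            -- The relation cannot rule this answer out, since `u` is related to every state; the
            -- label does.
            (_ , to-u x∈r , _)           → contradiction x∈r (l∪bi⇒¬r x∈l∪bi)
      }
      where open IsRefinement ref

proposition3 : ∀ {a ℓ s₁ t₁ s₂ t₂ r : Level} {A : Set a} (S : Signature A ℓ)
    (P : LTS A s₁ t₁) (Q : LTS A s₂ t₂)
    (R : REL (LTS.State P) (LTS.State Q) r) →
    IsCCSimulation S P Q R ⇔ IsRefinement (ℳ S P) (ℳ S Q) (ℳ-Rel R)
proposition3 S P Q R =
  mk⇔ (ccSimulation⇒refinement S) (refinement⇒ccSimulation S)
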